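{- Let $\mathcal{A}$ be a relational structure and $d\ge1$. The reachability problem for reversible Petri nets with data $\mathcal{A}$ with $d$ places reduces to the problem Ideal-memb in $\mathbb{Q}[\mathcal{A}\otimes\mathbf{d}]$, and also to Ideal-memb in $\mathbb{Z}[\mathcal{A}\otimes\mathbf{d}]$.
   Context: Relational structures are countable sets with finitely many relations, equality definable; embeddings preserve and reflect all relations; $\mathrm{Emb}(\mathcal{C})$ is the set of embeddings of $\mathcal{C}$. $\mathbf{d}=(\{0,\dots,d-1\},\le)$. The lexicographic product $\mathcal{A}\otimes\mathcal{A}'$ has carrier $A\times A'$; each $k$-ary relation $r$ of $\mathcal{A}$ holds of $((a_1,a'_1),\dots,(a_k,a'_k))$ iff $r(a_1,\dots,a_k)$, and each $k$-ary relation $r'$ of $\mathcal{A}'$ holds iff $a_1=\dots=a_k$ and $r'(a'_1,\dots,a'_k)$. For a structure $\mathcal{C}$, $M[\mathcal{C}]$ denotes the monoid of monomials whose variables are elements of $\mathcal{C}$. A monomial rewriting over $\mathcal{C}$ is a set $\mathcal{T}\subseteq M[\mathcal{C}]\times M[\mathcal{C}]$; it is orbit-finite if $\mathcal{T}=\{(\iota(h),\iota(h')):\iota\in\mathrm{Emb}(\mathcal{C}),(h,h')\in T\}$ for a finite presentation $T$ (embeddings act by renaming variables). Transitions: $g\cdot h\to g\cdot h'$ for $g\in M[\mathcal{C}]$, $(h,h')\in\mathcal{T}$; $\to^*$ is the reflexive-transitive closure. A Petri net with data $\mathcal{A}$ with $d$ places is an orbit-finite monomial rewriting over $\mathcal{A}\otimes\mathbf{d}$;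 it is reversible if $c\to^*c'$ implies $c'\to^*c$. The reachability problem: given a finite presentation $T$ and monomials $s,t\in M[\mathcal{A}\otimes\mathbf{d}]$, decide whether $s\to^*t$. Ideal-memb in $R[\mathcal{C}]$ ($R$ a ring): given a polynomial $f$ and a finite set $\mathcal{B}$ of polynomials over $R$ with variables from $\mathcal{C}$, decide whether $f=\sum_i h_i\cdot\iota_i(g_i)$ with $g_i\in\mathcal{B}$, $h_i\in R[\mathcal{C}]$, $\iota_i\in\mathrm{Emb}(\mathcal{C})$. -}

module Defs where

open import Level using (Level; 0ℓ) renaming (suc to lsuc)
open import Data.Nat as ℕ using (ℕ; zero; suc)
open import Data.Fin as Fin using (Fin; toℕ)
open import Data.Vec as Vec using (Vec; []; _∷_)
open import Data.List as List using (List; []; _∷_; _++_)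
open import Data.List.Membership.Propositional using (_∈_)
open import Data.List.Relation.Binary.Permutation.Propositional using (_↭_)
open import Data.Bool using (Bool; true; false; if_then_else_)
open import Data.Product using (Σ; ∃; _×_; _,_; proj₁; proj₂)
open import Data.Sum using (_⊎_; inj₁; inj₂)
open import Data.Unit using (⊤; tt)
open import Relation.Nullary using (does)
open import Relation.Binary.Definitions using (DecidableEquality)
open import Relation.Binary.PropositionalEquality using (_≡_)
open import Relation.Binary.Construct.Closure.ReflexiveTransitive using (Star)
open import Function.Definitions using (Injective)
open import Function.Bundles using (_⇔_)
open import Algebra.Bundles using (CommutativeRing)

record RelStr : Set₁ where
  field
    Carrier  : Set
    _≟_      : DecidableEquality Carrier
    code     : Carrier → ℕ                    -- countability
    code-inj : Injective _≡_ _≡_ code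
    nrel     : ℕ
    arity    : Fin nrel → ℕ
    rel      : (i : Fin nrel) → Vec Carrier (arity i) → Set

record Sig : Set₁ where
  field
    Car   : Set
    Idx   : Set
    ar    : Idx → ℕ
    R     : (i : Idx) → Vec Car (ar i) → Set

IsEmb : (S : Sig) → (Sig.Car S → Sig.Car S) → Set
IsEmb S ι = Injective _≡_ _≡_ ι
          × (∀ i (v : Vec Car (ar i)) → R i v ⇔ R i (Vec.map ι v))
  where open Sig S

Emb : Sig → Set
Emb S = Σ (Sig.Car S → Sig.Car S) (IsEmb S)

-- relation of 𝐝 : the single binary relation ≤
-- A ⊗ d : carrier A × Fin d; relations of A lifted on first coordinates,
-- and ≤ of d holding iff first coordinates agree and second are ≤.
module _ (A : RelStr) (d : ℕ) where
  open RelStr A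

  ProdCar : Set
  ProdCar = Carrier × Fin d

  prodAr : Fin nrel ⊎ ⊤ → ℕ
  prodAr (inj₁ i) = arity i
  prodAr (inj₂ _) = 2

  prodRel : (i : Fin nrel ⊎ ⊤) → Vec ProdCar (prodAr i) → Set
  prodRel (inj₁ i) v = rel i (Vec.map proj₁ v)
  prodRel (inj₂ _) (p ∷ q ∷ []) = (proj₁ p ≡ proj₁ q) × (toℕ (proj₂ p) ℕ.≤ toℕ (proj₂ q))

  A⊗d : Sig
  A⊗d = record { Car = ProdCar ; Idx = Fin nrel ⊎ ⊤ ; ar = prodAr ; R = prodRel }

-- Monomials over a set of variables: finite multisets, represented as
-- lists up to permutation; the product of monomials is concatenation.

Mono : Set → Set
Mono C = List C

renameM : {C : Set} → (C → C) → Mono C → Mono C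
renameM = List.map

-- Petri nets with data 𝒜 and d places (orbit-finite monomial rewriting
-- over 𝒜 ⊗ 𝐝, given by a finite presentation)

module Net (A : RelStr) (d : ℕ) where
  C : Set
  C = ProdCar A d

  Presentation : Set
  Presentation = List (Mono C × Mono C)

  InOrbit : Presentation → Mono C → Mono C → Set
  InOrbit T u u' = Σ (Emb (A⊗d A d)) λ ι → Σ (Mono C × Mono C) λ hh' →
    (hh' ∈ T) × (u ≡ renameM (proj₁ ι) (proj₁ hh')) × (u' ≡ renameM (proj₁ ι) (proj₂ hh'))

  Step : Presentation → Mono C → Mono C → Set
  Step T c c' = Σ (Mono C) λ g → Σ (Mono C) λ h → Σ (Mono C) λ h' →
    InOrbit T h h' × (c ↭ (g ++ h)) × (c' ↭ (g ++ h'))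

  Reach : Presentation → Mono C → Mono C → Set
  Reach T s t = Σ (Mono C) λ c → Star (Step T) s c × (c ↭ t)

  Reversible : Presentation → Set
  Reversible T = ∀ c c' → Reach T c c' → Reach T c' c

  Instance : Set
  Instance = Presentation × Mono C × Mono C

-- Polynomials with coefficients in a commutative ring R and variables in C
-- (C with decidable equality): finite lists of terms (coefficient, monomial),
-- two polynomials being equal iff all their coefficients agree.

module Polys (Rg : CommutativeRing 0ℓ 0ℓ) {C : Set} (_≟C_ : DecidableEquality C) where
  open CommutativeRing Rg renaming (Carrier to R)

  Poly : Set
  Poly = List (R × Mono C)

  count : C → Mono C → ℕ
  count x [] = 0
  count x (y ∷ m) = if does (x ≟C y) then suc (count x m) else count x m

  sameMono : Mono C → Mono C → Bool
  sameMono m m' = allB (m ++ m')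
    where
    allB : List C → Bool
    allB [] = true
    allB (x ∷ xs) = if does (count x m ℕ.≟ count x m') then allB xs else false

  coeff : Poly → Mono C → R
  coeff [] m = 0#
  coeff ((c , m') ∷ p) m = if sameMono m' m then c + coeff p m else coeff p m

  _≈P_ : Poly → Poly → Set
  p ≈P q = ∀ m → coeff p m ≈ coeff q m

  _+P_ : Poly → Poly → Poly
  _+P_ = _++_

  _*P_ : Poly → Poly → Poly
  p *P q = List.concatMap (λ t → List.map (λ s → (proj₁ t * proj₁ s , proj₂ t ++ proj₂ s)) q) p

  renameP : (C → C) → Poly → Poly
  renameP ι = List.map (λ t → (proj₁ t , renameM ι (proj₂ t)))

  sumP : List Poly → Poly
  sumP = List.foldr _+P_ []

module IdealMemb (Rg : CommutativeRing 0ℓ 0ℓ) (S : Sig) (_≟C_ : DecidableEquality (Sig.Car S)) where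
  open Polys Rg _≟C_ public

  InIdeal : Poly → List Poly → Set
  InIdeal f 𝓑 = Σ (List (Poly × Emb S × Poly)) λ ts →
    (∀ {t} → t ∈ ts → proj₂ (proj₂ t) ∈ 𝓑) ×
    (f ≈P sumP (List.map (λ t → proj₁ t *P renameP (proj₁ (proj₁ (proj₂ t))) (proj₂ (proj₂ t))) ts))

open import Data.Product.Properties using (≡-dec)
import Data.Fin.Properties as FinP

prodDec : (A : RelStr) (d : ℕ) → DecidableEquality (ProdCar A d)
prodDec A d = ≡-dec (RelStr._≟_ A) FinP._≟_

IdealMembIn : (Rg : CommutativeRing 0ℓ 0ℓ) → (A : RelStr) (d : ℕ) →
  Polys.Poly Rg (prodDec A d) → List (Polys.Poly Rg (prodDec A d)) → Set
IdealMembIn Rg A d = IdealMemb.InIdeal Rg (A⊗d A d) (prodDec A d)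

-- "The reachability problem for reversible Petri nets with data 𝒜 and d
-- places reduces to Ideal-memb in R[𝒜 ⊗ 𝐝]": a (constructive, hence
-- computable) map from instances (T, s, t) to instances (f, 𝓑) such that,
-- for reversible T, s →* t iff f lies in the ideal.
ReducesToIdealMemb : CommutativeRing 0ℓ 0ℓ → RelStr → ℕ → Set
ReducesToIdealMemb Rg A d =
  Σ (Instance → Polys.Poly Rg (prodDec A d) × List (Polys.Poly Rg (prodDec A d))) λ red →
    ∀ (x : Instance) → Reversible (proj₁ x) →
      (Reach (proj₁ x) (proj₁ (proj₂ x)) (proj₂ (proj₂ x))
        ⇔ IdealMembIn Rg A d (proj₁ (red x)) (proj₂ (red x)))
  where open Net A d

{-# OPTIONS --safe #-}
-- The reduction sends (T, s, t) to the binomial s − t and the binomials h − h′ for (h, h′) ∈ T.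
-- A run s →* t telescopes into a sum of translates g · ι(h − h′), so s − t lies in the ideal.
-- Conversely, every member of the ideal is a sum Σ cₖ (xₖ − yₖ) in which each xₖ → yₖ is a
-- transition. If s − t is such a sum and reachability is an equivalence (reversibility), then
-- s →* t: replacing every monomial equal to y₁ by x₁ respects equality of polynomials, cancels
-- the first term, keeps the remaining pairs mutually reachable and moves s and t only within
-- their reachability classes. Induction on the number of terms ends with s − t = 0, which
-- forces s = t as multisets because 1 ≠ 0.
module Submission where

open import Defs
open import Data.Nat using (ℕ; _≤_)
open import Data.Product using (_×_)
import Data.Rational.Properties as ℚP
import Data.Integer.Properties as ℤP

open import Level using (0ℓ)
open import Algebra.Bundles using (CommutativeRing)
open import Data.Bool using (Bool; true; false; T; if_then_else_)
open import Data.Bool.Properties using (T-≡)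
open import Data.Empty using (⊥-elim)
open import Data.List using (List; []; _∷_; _++_; map; length; concat)
open import Data.List.Properties using (length-map; map-++; concat-++; ++-identityʳ)
open import Data.List.Membership.Propositional using (_∈_)
open import Data.List.Membership.Propositional.Properties
  using (∈-∃++; ∈-++⁺ˡ; ∈-++⁺ʳ; ∈-++⁻; ∈-map⁺; ∈-map⁻)
open import Data.List.Relation.Unary.Any using (here; there)
open import Data.List.Relation.Unary.All as All using (All; []; _∷_)
import Data.List.Relation.Unary.All.Properties as AllP
open import Data.List.Relation.Binary.Permutation.Propositional
  using (_↭_; prep; ↭-refl; ↭-sym; ↭-trans)
open import Data.List.Relation.Binary.Permutation.Propositional.Properties using (shift)
open import Data.Nat as ℕ using (zero; suc)
import Data.Nat.Properties as ℕP
open import Data.Product as Product using (Σ; _,_; proj₁; proj₂)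
open import Data.Sum using ([_,_]′)
open import Function using (_∘_)
open import Function.Bundles using (Equivalence; mk⇔)
open import Relation.Binary.Core using (Rel; _⇒_)
open import Relation.Binary.Construct.Closure.ReflexiveTransitive using (Star; ε; _◅_; _◅◅_)
open import Relation.Binary.Definitions using (DecidableEquality; Symmetric; Transitive)
open import Relation.Binary.PropositionalEquality as ≡ using (_≡_; _≢_)
open import Relation.Binary.Structures using (IsEquivalence)
open import Relation.Nullary using (¬_; does; yes; no; contradiction)
open import Relation.Nullary.Reflects using (Reflects; ofʸ; ofⁿ; fromEquivalence; det)

module MonomialEquality (Rg : CommutativeRing 0ℓ 0ℓ) {C : Set} (_≟C_ : DecidableEquality C) where
  open Polys Rg _≟C_ using (count; sameMono)
  open import Data.List.Membership.DecPropositional _≟C_ using (_∈?_)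
  open import Data.List.Relation.Binary.Permutation.Propositional using (refl; swap; trans)

  count-↭ : ∀ {a b} → a ↭ b → ∀ x → count x a ≡ count x b
  count-↭ refl x = ≡.refl
  count-↭ (prep y p) x with does (x ≟C y)
  ... | true = ≡.cong suc (count-↭ p x)
  ... | false = count-↭ p x
  count-↭ (swap y z p) x with does (x ≟C y) | does (x ≟C z)
  ... | true  | true  = ≡.cong (suc ∘ suc) (count-↭ p x)
  ... | true  | false = ≡.cong suc (count-↭ p x)
  ... | false | true  = ≡.cong suc (count-↭ p x)
  ... | false | false = count-↭ p x
  count-↭ (trans p q) x = ≡.trans (count-↭ p x) (count-↭ q x)

  count≢0⇒∈ : ∀ {x} l → count x l ≢ 0 → x ∈ l
  count≢0⇒∈ [] count≢0 = ⊥-elim (count≢0 ≡.refl)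
  count≢0⇒∈ {x} (y ∷ l) count≢0 with x ≟C y
  ... | yes x≡y = here x≡y
  ... | no _ = there (count≢0⇒∈ l count≢0)

  ∉⇒count≡0 : ∀ {x} l → ¬ x ∈ l → count x l ≡ 0
  ∉⇒count≡0 [] _ = ≡.refl
  ∉⇒count≡0 {x} (y ∷ l) x∉ with x ≟C y
  ... | yes x≡y = contradiction (here x≡y) x∉
  ... | no _ = ∉⇒count≡0 l (x∉ ∘ there)

  count-head≢0 : ∀ x l → count x (x ∷ l) ≢ 0
  count-head≢0 x l with x ≟C x
  ... | yes _ = λ ()
  ... | no x≢x = contradiction ≡.refl x≢x

  count-∷-cancel : ∀ x y a b → count y (x ∷ a) ≡ count y (x ∷ b) → count y a ≡ count y b
  count-∷-cancel x y _ _ eq with does (y ≟C x)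
  ... | true = ℕP.suc-injective eq
  ... | false = eq

  count-≡⇒↭ : ∀ a b → (∀ x → count x a ≡ count x b) → a ↭ b
  count-≡⇒↭ [] [] _ = ↭-refl
  count-≡⇒↭ [] (y ∷ b) eq = contradiction (≡.sym (eq y)) (count-head≢0 y b)
  count-≡⇒↭ (x ∷ a) b eq
    with ys , zs , ≡.refl ← ∈-∃++ (count≢0⇒∈ b (count-head≢0 x a ∘ ≡.trans (eq x)))
    = ↭-trans (prep x (count-≡⇒↭ a (ys ++ zs) counts)) (↭-sym (shift x ys zs))
    where
    counts : ∀ y → count y a ≡ count y (ys ++ zs)
    counts y = count-∷-cancel x y a (ys ++ zs) (≡.trans (eq y) (count-↭ (shift x ys zs) y))

  module _ (a b : Mono C) where
    -- The helper in the definition of sameMono is not in scope; unification recovers it.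
    private
      mutual
        allCounts : List C → Bool
        allCounts = _

        sameMono≡allCounts : sameMono a b ≡ allCounts (a ++ b)
        sameMono≡allCounts with a ++ b
        ... | _ = ≡.refl

      allCounts-sound : ∀ xs → T (allCounts xs) → All (λ x → count x a ≡ count x b) xs
      allCounts-sound [] _ = []
      -- The test does (m ℕ.≟ n) in sameMono computes to m ℕ.≡ᵇ n, so that is what we abstract.
      allCounts-sound (x ∷ xs) t with count x a ℕ.≡ᵇ count x b | ℕP.≡ᵇ⇒≡ (count x a) (count x b)
      ... | true | ≡ᵇ⇒≡ = ≡ᵇ⇒≡ _ ∷ allCounts-sound xs t

      allCounts-complete : ∀ xs → All (λ x → count x a ≡ count x b) xs → T (allCounts xs)
      allCounts-complete [] [] = _
      allCounts-complete (x ∷ xs) (eq ∷ eqs)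
        with count x a ℕ.≡ᵇ count x b | ℕP.≡⇒≡ᵇ (count x a) (count x b) eq
      ... | true | _ = allCounts-complete xs eqs

    sameMono⇒↭ : T (sameMono a b) → a ↭ b
    sameMono⇒↭ t = count-≡⇒↭ a b counts
      where
      same : All (λ x → count x a ≡ count x b) (a ++ b)
      same = allCounts-sound (a ++ b) (≡.subst T sameMono≡allCounts t)
      counts : ∀ x → count x a ≡ count x b
      counts x with x ∈? a ++ b
      ... | yes x∈ = All.lookup same x∈
      ... | no x∉ =
        ≡.trans (∉⇒count≡0 a (x∉ ∘ ∈-++⁺ˡ)) (≡.sym (∉⇒count≡0 b (x∉ ∘ ∈-++⁺ʳ a)))

    ↭⇒sameMono : a ↭ b → T (sameMono a b)
    ↭⇒sameMono a↭b = ≡.subst T (≡.sym sameMono≡allCounts)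
      (allCounts-complete (a ++ b) (All.tabulate λ {x} _ → count-↭ a↭b x))

    sameMono-reflects : Reflects (a ↭ b) (sameMono a b)
    sameMono-reflects = fromEquivalence sameMono⇒↭ ↭⇒sameMono

  sameMono-refl : ∀ a → sameMono a a ≡ true
  sameMono-refl a = Equivalence.to T-≡ (↭⇒sameMono a a ↭-refl)

  sameMono-congˡ : ∀ {a a′ b} → a ↭ a′ → sameMono a b ≡ sameMono a′ b
  sameMono-congˡ {a} {a′} {b} a↭a′ = det
    (fromEquivalence (↭-trans (↭-sym a↭a′) ∘ sameMono⇒↭ a b)
                     (↭⇒sameMono a b ∘ ↭-trans a↭a′))
    (sameMono-reflects a′ b)

module Coefficients (Rg : CommutativeRing 0ℓ 0ℓ) {C : Set} (_≟C_ : DecidableEquality C) where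
  open Polys Rg _≟C_
  open MonomialEquality Rg _≟C_
  open CommutativeRing Rg renaming (Carrier to R)
  open import Algebra.Properties.CommutativeSemigroup +-commutativeSemigroup using (x∙yz≈y∙xz)

  -- _≈P_ wrapped in a record, so that the compared polynomials can be inferred.
  infix 4 _≋_
  record _≋_ (p q : Poly) : Set where
    constructor mk≋
    field coeff-≈ : p ≈P q
  open _≋_ public

  ≋-isEquivalence : IsEquivalence _≋_
  ≋-isEquivalence = record
    { refl = mk≋ λ _ → refl
    ; sym = λ p≋q → mk≋ λ m → sym (coeff-≈ p≋q m)
    ; trans = λ p≋q q≋r → mk≋ λ m → trans (coeff-≈ p≋q m) (coeff-≈ q≋r m)
    }

  open IsEquivalence ≋-isEquivalence public
    using () renaming (refl to ≋-refl; sym to ≋-sym; trans to ≋-trans; reflexive to ≋-reflexive)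

  coeff-++ : ∀ p q m → coeff (p ++ q) m ≈ coeff p m + coeff q m
  coeff-++ [] q m = sym (+-identityˡ _)
  coeff-++ ((c , n) ∷ p) q m with sameMono n m
  ... | true = trans (+-congˡ (coeff-++ p q m)) (sym (+-assoc _ _ _))
  ... | false = coeff-++ p q m

  ++-cong : ∀ {p p′ q q′} → p ≋ p′ → q ≋ q′ → p ++ q ≋ p′ ++ q′
  ++-cong {p} {p′} {q} {q′} p≋p′ q≋q′ = mk≋ λ m →
    trans (coeff-++ p q m)
          (trans (+-cong (coeff-≈ p≋p′ m) (coeff-≈ q≋q′ m)) (sym (coeff-++ p′ q′ m)))

  ∷-cong : ∀ {c c′ a a′ p q} → c ≈ c′ → a ↭ a′ → p ≋ q →
           (c , a) ∷ p ≋ (c′ , a′) ∷ q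
  ∷-cong {c} {c′} {a} {a′} {p} {q} c≈c′ a↭a′ p≋q = mk≋ at
    where
    at : ((c , a) ∷ p) ≈P ((c′ , a′) ∷ q)
    at m rewrite sameMono-congˡ {b = m} a↭a′ with sameMono a′ m
    ... | true = +-cong c≈c′ (coeff-≈ p≋q m)
    ... | false = coeff-≈ p≋q m

  ∷-cancel : ∀ {x y} u p → x + y ≈ 0# → (x , u) ∷ (y , u) ∷ p ≋ p
  ∷-cancel {x} {y} u p x+y≈0 = mk≋ at
    where
    at : ((x , u) ∷ (y , u) ∷ p) ≈P p
    at m with sameMono u m
    ... | true = trans (sym (+-assoc _ _ _)) (trans (+-congʳ x+y≈0) (+-identityˡ _))
    ... | false = refl

  binomial : Mono C → Mono C → Poly
  binomial a b = (1# , a) ∷ (- 1# , b) ∷ []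

  binomial-self : ∀ a → binomial a a ≋ []
  binomial-self a = ∷-cancel a [] (-‿inverseʳ 1#)

  binomial-split : ∀ a b c → binomial a c ≋ binomial a b ++ binomial b c
  binomial-split a b c = ∷-cong refl ↭-refl (≋-sym (∷-cancel b _ (-‿inverseˡ 1#)))

  binomial-resp-↭ : ∀ {a a′ b b′} → a ↭ a′ → b ↭ b′ → binomial a b ≋ binomial a′ b′
  binomial-resp-↭ a↭a′ b↭b′ = ∷-cong refl a↭a′ (∷-cong refl b↭b′ ≋-refl)

  binomial≋0⇒↭ : ¬ (1# ≈ 0#) → ∀ {a b} → binomial a b ≋ [] → a ↭ b
  binomial≋0⇒↭ 1≉0 {a} {b} a-b≋0 = coefficient-at-a (coeff-≈ a-b≋0 a)
    where
    coefficient-at-a : coeff (binomial a b) a ≈ 0# → a ↭ b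
    coefficient-at-a rewrite sameMono-refl a with sameMono b a | sameMono-reflects b a
    ... | true | ofʸ b↭a = λ _ → ↭-sym b↭a
    ... | false | _ = λ 1+0≈0 → contradiction (trans (sym (+-identityʳ 1#)) 1+0≈0) 1≉0

  Edge : Set
  Edge = R × Mono C × Mono C

  -- Σ c · (x − y), in the shape in which _*P_ produces it.
  ∑edges : List Edge → Poly
  ∑edges [] = []
  ∑edges ((c , x , y) ∷ E) = (c * 1# , x) ∷ (c * - 1# , y) ∷ ∑edges E

  Joins : Rel (Mono C) 0ℓ → Edge → Set
  Joins _~_ (_ , x , y) = x ~ y

  ∑edges-unit : ∀ x y → ∑edges ((1# , x , y) ∷ []) ≋ binomial x y
  ∑edges-unit x y = ∷-cong (*-identityˡ 1#) ↭-refl (∷-cong (*-identityˡ (- 1#)) ↭-refl ≋-refl)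

  ∑edges-++ : ∀ E E′ → ∑edges (E ++ E′) ≡ ∑edges E ++ ∑edges E′
  ∑edges-++ [] E′ = ≡.refl
  ∑edges-++ ((c , x , y) ∷ E) E′ =
    ≡.cong (λ p → (c * 1# , x) ∷ (c * - 1# , y) ∷ p) (∑edges-++ E E′)

  multiples : Mono C → Mono C → Poly → List Edge
  multiples x y = map (λ (c , m) → c , m ++ x , m ++ y)

  *P-binomial : ∀ p x y → p *P binomial x y ≡ ∑edges (multiples x y p)
  *P-binomial [] x y = ≡.refl
  *P-binomial ((c , m) ∷ p) x y =
    ≡.cong (λ q → (c * 1# , m ++ x) ∷ (c * - 1# , m ++ y) ∷ q) (*P-binomial p x y)

  collapse : Mono C → Mono C → Mono C → Mono C
  collapse u v m = if sameMono m v then u else m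

  collapse-target : ∀ u v → collapse u v v ≡ u
  collapse-target u v rewrite sameMono-refl v = ≡.refl

  collapse-source : ∀ u v → collapse u v u ≡ u
  collapse-source u v with sameMono u v
  ... | true = ≡.refl
  ... | false = ≡.refl

  collapseP : Mono C → Mono C → Poly → Poly
  collapseP u v = map (Product.map₂ (collapse u v))

  collapseE : Mono C → Mono C → List Edge → List Edge
  collapseE u v = map (Product.map₂ (Product.map (collapse u v) (collapse u v)))

  collapseP-∑edges : ∀ u v E → collapseP u v (∑edges E) ≡ ∑edges (collapseE u v E)
  collapseP-∑edges u v [] = ≡.refl
  collapseP-∑edges u v ((c , x , y) ∷ E) =
    ≡.cong (λ p → (c * 1# , collapse u v x) ∷ (c * - 1# , collapse u v y) ∷ p)
           (collapseP-∑edges u v E)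

  coeff-collapseP : ∀ u v p m → coeff (collapseP u v p) m ≈
    (if sameMono u m then coeff p v else 0#) + (if sameMono v m then 0# else coeff p m)
  coeff-collapseP u v [] m with sameMono u m | sameMono v m
  ... | true  | true  = sym (+-identityˡ 0#)
  ... | true  | false = sym (+-identityˡ 0#)
  ... | false | true  = sym (+-identityˡ 0#)
  ... | false | false = sym (+-identityˡ 0#)
  coeff-collapseP u v ((c , n) ∷ p) m with sameMono n v | sameMono-reflects n v
  ... | true | ofʸ n↭v rewrite sameMono-congˡ {b = m} n↭v
      with sameMono u m | sameMono v m | coeff-collapseP u v p m
  ...   | true  | true  | ih = trans (+-congˡ ih) (sym (+-assoc _ _ _))
  ...   | true  | false | ih = trans (+-congˡ ih) (sym (+-assoc _ _ _))
  ...   | false | true  | ih = ih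
  ...   | false | false | ih = ih
  coeff-collapseP u v ((c , n) ∷ p) m | false | ofⁿ n≁v
      with sameMono n m | sameMono-reflects n m | sameMono v m | sameMono-reflects v m
         | coeff-collapseP u v p m
  ...   | false | _        | _     | _        | ih = ih
  ...   | true  | ofʸ n↭m  | true  | ofʸ v↭m  | _  = contradiction (↭-trans n↭m (↭-sym v↭m)) n≁v
  ...   | true  | _        | false | _        | ih = trans (+-congˡ ih) (x∙yz≈y∙xz c _ _)

  collapseP-cong : ∀ u v {p q} → p ≋ q → collapseP u v p ≋ collapseP u v q
  collapseP-cong u v {p} {q} p≋q = mk≋ λ m →
    trans (coeff-collapseP u v p m)
      (trans (+-cong (if-cong (sameMono u m) (coeff-≈ p≋q v) refl)
                     (if-cong (sameMono v m) refl (coeff-≈ p≋q m)))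
             (sym (coeff-collapseP u v q m)))
    where
    if-cong : ∀ b {x x′ y y′} → x ≈ x′ → y ≈ y′ →
              (if b then x else y) ≈ (if b then x′ else y′)
    if-cong true x≈x′ _ = x≈x′
    if-cong false _ y≈y′ = y≈y′

  collapse-edge : ∀ c u v E → collapseP u v (∑edges ((c , u , v) ∷ E)) ≋ ∑edges (collapseE u v E)
  collapse-edge c u v E
    rewrite collapse-source u v | collapse-target u v | collapseP-∑edges u v E =
    ∷-cancel u _ (trans (sym (distribˡ c 1# (- 1#))) (trans (*-congˡ (-‿inverseʳ 1#)) (zeroʳ c)))

module Contraction (Rg : CommutativeRing 0ℓ 0ℓ) {C : Set} (_≟C_ : DecidableEquality C)
  (1≉0 : ¬ CommutativeRing._≈_ Rg (CommutativeRing.1# Rg) (CommutativeRing.0# Rg))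
  (_~_ : Rel (List C) 0ℓ) (↭⇒~ : _↭_ ⇒ _~_) (~-sym : Symmetric _~_) (~-trans : Transitive _~_)
  where
  open Polys Rg _≟C_ using (sameMono)
  open MonomialEquality Rg _≟C_
  open Coefficients Rg _≟C_

  ~-collapse : ∀ {u v} → u ~ v → ∀ m → m ~ collapse u v m
  ~-collapse {u} {v} u~v m with sameMono m v | sameMono-reflects m v
  ... | true | ofʸ m↭v = ~-trans (↭⇒~ m↭v) (~-sym u~v)
  ... | false | _ = ↭⇒~ ↭-refl

  collapseE-joins : ∀ {u v} → u ~ v → ∀ {E} → All (Joins _~_) E → All (Joins _~_) (collapseE u v E)
  collapseE-joins u~v = AllP.map⁺ ∘ All.map λ {(_ , x , y)} x~y →
    ~-trans (~-sym (~-collapse u~v x)) (~-trans x~y (~-collapse u~v y))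

  private
    contract : ∀ n E → length E ≡ n → All (Joins _~_) E →
               ∀ a b → binomial a b ≋ ∑edges E → a ~ b
    contract zero [] _ [] a b a-b≋0 = ↭⇒~ (binomial≋0⇒↭ 1≉0 a-b≋0)
    contract (suc n) ((c , u , v) ∷ E) |E|≡1+n (u~v ∷ joins) a b a-b≋ =
      ~-trans (~-collapse u~v a)
        (~-trans (contract n (collapseE u v E) |E′|≡n (collapseE-joins u~v joins) _ _ collapsed)
                 (~-sym (~-collapse u~v b)))
      where
      |E′|≡n : length (collapseE u v E) ≡ n
      |E′|≡n = ≡.trans (length-map _ E) (ℕP.suc-injective |E|≡1+n)
      collapsed : binomial (collapse u v a) (collapse u v b) ≋ ∑edges (collapseE u v E)
      collapsed = ≋-trans (collapseP-cong u v a-b≋) (collapse-edge c u v E)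

  binomial≋∑edges⇒~ : ∀ E → All (Joins _~_) E → ∀ {a b} → binomial a b ≋ ∑edges E → a ~ b
  binomial≋∑edges⇒~ E joins = contract (length E) E ≡.refl joins _ _

module IdealClosure (Rg : CommutativeRing 0ℓ 0ℓ) (S : Sig) (_≟C_ : DecidableEquality (Sig.Car S)) where
  open IdealMemb Rg S _≟C_
  open Coefficients Rg _≟C_

  combination : List (Poly × Emb S × Poly) → Poly
  combination ts =
    sumP (map (λ t → proj₁ t *P renameP (proj₁ (proj₁ (proj₂ t))) (proj₂ (proj₂ t))) ts)

  combination≋ : ∀ {f B} ((ts , _) : InIdeal f B) → f ≋ combination ts
  combination≋ (_ , _ , f≈) = mk≋ f≈

  InIdeal-resp-≋ : ∀ {f g B} → f ≋ g → InIdeal f B → InIdeal g B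
  InIdeal-resp-≋ {f} f≋g I@(ts , gens , _) =
    ts , gens , coeff-≈ (≋-trans (≋-sym f≋g) (combination≋ {f} I))

  []-InIdeal : ∀ B → InIdeal [] B
  []-InIdeal B = [] , (λ ()) , coeff-≈ (≋-refl {[]})

  ++-InIdeal : ∀ {f g B} → InIdeal f B → InIdeal g B → InIdeal (f ++ g) B
  ++-InIdeal {f} {g} I@(ts , gens , _) J@(ts′ , gens′ , _) =
    ts ++ ts′ , [ gens , gens′ ]′ ∘ ∈-++⁻ ts ,
    coeff-≈ (≋-trans (++-cong (combination≋ {f} I) (combination≋ {g} J))
                     (≋-reflexive combination-++))
    where
    combination-++ : combination ts ++ combination ts′ ≡ combination (ts ++ ts′)
    combination-++ =
      ≡.trans (concat-++ (map _ ts) (map _ ts′)) (≡.cong concat (≡.sym (map-++ _ ts ts′)))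

  multiple-InIdeal : ∀ {g B} → g ∈ B → ∀ p ι → InIdeal (p *P renameP (proj₁ ι) g) B
  multiple-InIdeal {g} g∈B p ι = ((p , ι , g) ∷ []) , (λ { (here ≡.refl) → g∈B }) ,
    coeff-≈ (≋-reflexive {p *P renameP (proj₁ ι) g} (≡.sym (++-identityʳ _)))

module ReversibleNets (Rg : CommutativeRing 0ℓ 0ℓ)
  (1≉0 : ¬ CommutativeRing._≈_ Rg (CommutativeRing.1# Rg) (CommutativeRing.0# Rg))
  (A : RelStr) (d : ℕ) where
  open Net A d
  open IdealMemb Rg (A⊗d A d) (prodDec A d)
  open Coefficients Rg (prodDec A d)
  open IdealClosure Rg (A⊗d A d) (prodDec A d)
  open CommutativeRing Rg using (1#)

  generators : Presentation → List Poly
  generators = map (Product.uncurry binomial)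

  reduce : Instance → Poly × List Poly
  reduce (T , s , t) = binomial s t , generators T

  module _ (T : Presentation) where

    ↭⇒Reach : ∀ {a b} → a ↭ b → Reach T a b
    ↭⇒Reach a↭b = _ , ε , a↭b

    Step⇒Reach : ∀ {a b} → Step T a b → Reach T a b
    Step⇒Reach step = _ , step ◅ ε , ↭-refl

    Step-respˡ-↭ : ∀ {a b c} → a ↭ b → Step T b c → Step T a c
    Step-respˡ-↭ a↭b (g , h , h′ , orbit , b↭ , c↭) = g , h , h′ , orbit , ↭-trans a↭b b↭ , c↭

    Reach-trans : Transitive (Reach T)
    Reach-trans (c , run , c↭b) (_ , ε , b↭e) = c , run , ↭-trans c↭b b↭e
    Reach-trans (c , run , c↭b) (d , step ◅ run′ , d↭e) =
      d , run ◅◅ Step-respˡ-↭ c↭b step ◅ run′ , d↭e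

    Step⇒InIdeal : ∀ {a b} → Step T a b → InIdeal (binomial a b) (generators T)
    Step⇒InIdeal (g , _ , _ , (ι , (h , h′) , hh′∈T , ≡.refl , ≡.refl) , a↭ , b↭) =
      InIdeal-resp-≋
        (≋-trans (∑edges-unit (g ++ ιh) (g ++ ιh′)) (binomial-resp-↭ (↭-sym a↭) (↭-sym b↭)))
        (multiple-InIdeal (∈-map⁺ _ hh′∈T) ((1# , g) ∷ []) ι)
      where
      ιh = renameM (proj₁ ι) h
      ιh′ = renameM (proj₁ ι) h′

    Run⇒InIdeal : ∀ {a b} → Star (Step T) a b → InIdeal (binomial a b) (generators T)
    Run⇒InIdeal {a} ε = InIdeal-resp-≋ (≋-sym (binomial-self a)) ([]-InIdeal _)
    Run⇒InIdeal {a} {c} (_◅_ {j = b} step run) =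
      InIdeal-resp-≋ (≋-sym (binomial-split a b c))
        (++-InIdeal {binomial a b} {binomial b c} (Step⇒InIdeal step) (Run⇒InIdeal run))

    Reach⇒InIdeal : ∀ {s t} → Reach T s t → InIdeal (binomial s t) (generators T)
    Reach⇒InIdeal {s} (_ , run , c↭t) =
      InIdeal-resp-≋ (binomial-resp-↭ (↭-refl {x = s}) c↭t) (Run⇒InIdeal run)

    multiples-step : ∀ ι {h h′} → (h , h′) ∈ T → ∀ p →
      All (Joins (Step T)) (multiples (renameM (proj₁ ι) h) (renameM (proj₁ ι) h′) p)
    multiples-step ι hh′∈T p = AllP.map⁺ (All.universal
      (λ (_ , m) → m , _ , _ , (ι , _ , hh′∈T , ≡.refl , ≡.refl) , ↭-refl , ↭-refl) p)

    combination≡∑edges : ∀ ts → (∀ {t} → t ∈ ts → proj₂ (proj₂ t) ∈ generators T) →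
      Σ (List Edge) λ E → combination ts ≡ ∑edges E × All (Joins (Step T)) E
    combination≡∑edges [] _ = [] , ≡.refl , []
    combination≡∑edges ((p , ι , _) ∷ ts) gens
      with (h , h′) , hh′∈T , ≡.refl ← ∈-map⁻ _ (gens (here ≡.refl))
         | E , ≡∑E , steps ← combination≡∑edges ts (gens ∘ there)
      = _ ++ E , ≡.trans (≡.cong₂ _++_ (*P-binomial p _ _) ≡∑E) (≡.sym (∑edges-++ _ E)) ,
        AllP.++⁺ (multiples-step ι hh′∈T p) steps

    module _ (reversible : Reversible T) where
      open Contraction Rg (prodDec A d) 1≉0 (Reach T) ↭⇒Reach (reversible _ _) Reach-trans

      InIdeal⇒Reach : ∀ {s t} → InIdeal (binomial s t) (generators T) → Reach T s t
      InIdeal⇒Reach {s} {t} I@(ts , gens , _)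
        with E , ≡∑E , steps ← combination≡∑edges ts gens =
        binomial≋∑edges⇒~ E (All.map Step⇒Reach steps)
          (≋-trans (combination≋ {binomial s t} I) (≋-reflexive ≡∑E))

  reduction : ReducesToIdealMemb Rg A d
  reduction = reduce , λ (T , s , t) reversible → mk⇔ (Reach⇒InIdeal T) (InIdeal⇒Reach T reversible)

-- The reduction does not need d ≥ 1.
theorem8p2 : (A : RelStr) (d : ℕ) → 1 ≤ d →
    ReducesToIdealMemb ℚP.+-*-commutativeRing A d × ReducesToIdealMemb ℤP.+-*-commutativeRing A d
theorem8p2 A d _ =
  ReversibleNets.reduction ℚP.+-*-commutativeRing (λ ()) A d ,
  ReversibleNets.reduction ℤP.+-*-commutativeRing (λ ()) A d
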